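{- Let $AP$ be a set of atomic propositions and $Ag$ a finite set of agents. Global and local announcement logic (GLAL), with language $\mathcal{L}_{glal}$, is strictly more expressive than epistemic logic with common knowledge, with language $\mathcal{L}_{el}$. That is: (1) every formula of $\mathcal{L}_{el}$ is equivalent to some formula of $\mathcal{L}_{glal}$; and (2) there is a formula of $\mathcal{L}_{glal}$ that is not equivalent to any formula of $\mathcal{L}_{el}$. Here two formulas are equivalent if they are satisfied at exactly the same pointed models $(\mathcal{M},w)$.
   Context: Language. $AP$ is a set of atoms and $Ag$ a finite set of agents. The formulas of $\mathcal{L}_{glal}$ are given, for $p\in AP$ and $A\subseteq Ag$, by $\psi ::= p \mid \neg\psi \mid \psi\land\psi \mid C_A\psi \mid [\psi]^+_A\psi \mid [\psi]^-_A\psi$. The fragment $\mathcal{L}_{el}$ is obtained by dropping the clauses $[\psi]^+_A\psi$ and $[\psi]^-_A\psi$. Other Boolean connectives are defined as usual. Models. A (Kripke) model is $\mathcal{M}=\langle W,\{R_a\}_{a\in Ag},V\rangle$ with $W$ a set of worlds, each $R_a$ an equivalence relation on $W$, and $V:AP\to 2^W$. A pointed model is a pair $(\mathcal{M},w)$ with $w\in W$. For $w\in W$, $R_a(w)=\{w' : R_a(w,w')\}$; for $A\subseteq Ag$, $R^C_A=(\bigcup_{a\in A}R_a)^*$ is the reflexive and transitive closure of the union, and $R^C_A(w)=\{w' : R^C_A(w,w')\}$. Semantics. The satisfaction set $[\![\varphi]\!]_{\mathcal{M}}\subseteq W$ is defined by: $[\![p]\!]_{\mathcal{M}}=V(p)$;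 $[\![\neg\psi]\!]_{\mathcal{M}}=W\setminus[\![\psi]\!]_{\mathcal{M}}$; $[\![\psi\land\psi']\!]_{\mathcal{M}}=[\![\psi]\!]_{\mathcal{M}}\cap[\![\psi']\!]_{\mathcal{M}}$; $[\![C_A\psi]\!]_{\mathcal{M}}=\{w : R^C_A(w)\subseteq[\![\psi]\!]_{\mathcal{M}}\}$; and for $\star\in\{+,-\}$, $[\![[\psi]^\star_A\psi']\!]_{\mathcal{M}}=\{w : \text{if } w\in[\![\psi]\!]_{\mathcal{M}} \text{ then } w\in[\![\psi']\!]_{\mathcal{M}^\star_{(w,\psi,A)}}\}$. The refinements $\mathcal{M}^-_{(w,\psi,A)}$ and $\mathcal{M}^+_{(w,\psi,A)}$ have the same worlds and valuation as $\mathcal{M}$ and relations $R^-_b=R^+_b=R_b$ for $b\notin A$, while for $a\in A$: $R^-_a(v)=R_a(v)\cap[\![\psi]\!]_{\mathcal{M}}$ if $v\in R_a(w)\cap[\![\psi]\!]_{\mathcal{M}}$; $R^-_a(v)=R_a(v)\cap[\![\neg\psi]\!]_{\mathcal{M}}$ if $v\in R_a(w)\cap[\![\neg\psi]\!]_{\mathcal{M}}$; $R^-_a(v)=R_a(v)$ otherwise; and $R^+_a(v)$ is defined by the same three cases with $R_a(w)$ replaced by $R^C_A(w)$ in the case conditions. We write $(\mathcal{M},w)\models\varphi$ ("$\varphi$ is satisfied at $(\mathcal{M},w)$") for $w\in[\![\varphi]\!]_{\mathcal{M}}$.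
   Formalization: Part (2) is stated for a nonempty set AP and at least two agents; without these it is false: with AP empty there are no formulas, and with at most one agent every formula of GLAL is equivalent to one of epistemic logic. -}

module Defs where

open import Axiom.ExcludedMiddle using (ExcludedMiddle)
open import Data.Bool using (if_then_else_)
open import Data.Empty using (⊥-elim)
open import Data.Fin using (Fin)
open import Data.Fin.Subset using (Subset; _∈_)
open import Data.Fin.Subset.Properties using (_∈?_)
open import Data.Nat using (ℕ)
open import Data.Product using (∃; _×_; _,_)
open import Function.Bundles using (_⇔_)
open import Level using (0ℓ)
open import Relation.Binary.Construct.Closure.ReflexiveTransitive using (Star; ε; _◅_; _◅◅_)
open import Relation.Binary.Core using (Rel)
open import Relation.Binary.Structures using (IsEquivalence)
open import Relation.Nullary using (¬_; Dec; does; yes; no)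
open import Relation.Unary using (Pred)

infix  20 ¬′_
infixr 15 _∧′_
infix  4 _∣_⊨_ _≋_

data Formula (AP : Set) (n : ℕ) : Set where
  atom      : AP → Formula AP n
  ¬′_       : Formula AP n → Formula AP n
  _∧′_      : Formula AP n → Formula AP n → Formula AP n
  C         : Subset n → Formula AP n → Formula AP n
  [_]⁺⟨_⟩_  : Formula AP n → Subset n → Formula AP n → Formula AP n
  [_]⁻⟨_⟩_  : Formula AP n → Subset n → Formula AP n → Formula AP n

data EL {AP : Set} {n : ℕ} : Formula AP n → Set where
  atom : ∀ p → EL (atom p)
  ¬′_  : ∀ {φ} → EL φ → EL (¬′ φ)
  _∧′_ : ∀ {φ ψ} → EL φ → EL ψ → EL (φ ∧′ ψ)
  C    : ∀ A {φ} → EL φ → EL (C A φ)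

-- The satisfaction relation is defined on structures whose relations need not
-- be equivalences: a refinement of a model is again a model, but proving this
-- takes excluded middle (see `local-isModel` and `global-isModel` below).
record Structure (AP : Set) (n : ℕ) : Set₁ where
  field
    W : Set
    R : Fin n → Rel W 0ℓ
    V : AP → Pred W 0ℓ

  Rᶜ : Subset n → Rel W 0ℓ
  Rᶜ A = Star (λ v u → ∃ λ a → a ∈ A × R a v u)

open Structure public using (W)

IsModel : ∀ {AP n} → Structure AP n → Set
IsModel M = ∀ a → IsEquivalence (Structure.R M a)

record Model (AP : Set) (n : ℕ) : Set₁ where
  field
    structure : Structure AP n
    isModel   : IsModel structure

  open Structure structure public

open Model public using (structure)

-- `Split S P R v` is the set R(v) ∩ P if v ∈ S ∩ P, the set R(v) ∖ P if
-- v ∈ S ∖ P, and R(v) otherwise.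
data Split {X : Set} (S P : Pred X 0ℓ) (R : Rel X 0ℓ) (v u : X) : Set where
  inside    : S v × P v   → R v u × P u   → Split S P R v u
  outside   : S v × ¬ P v → R v u × ¬ P u → Split S P R v u
  otherwise : ¬ (S v × P v) → ¬ (S v × ¬ P v) → R v u → Split S P R v u

refine : ∀ {AP n} (M : Structure AP n) → (Fin n → Pred (W M) 0ℓ) →
         Pred (W M) 0ℓ → Subset n → Structure AP n
refine M S P A = record
  { W = W M
  ; R = λ a → if does (a ∈? A) then Split (S a) P (R a) else R a
  ; V = V
  }
  where open Structure M using (R; V)

global local : ∀ {AP n} (M : Structure AP n) → W M → Pred (W M) 0ℓ → Subset n → Structure AP n
global M w P A = refine M (λ _ v → Structure.Rᶜ M A w v) P A
local  M w P A = refine M (λ a v → Structure.R M a w v) P A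

⟦_⟧ : ∀ {AP n} → Formula AP n → (M : Structure AP n) → Pred (W M) 0ℓ
⟦ atom p ⟧        M w = Structure.V M p w
⟦ ¬′ φ ⟧          M w = ¬ ⟦ φ ⟧ M w
⟦ φ ∧′ ψ ⟧        M w = ⟦ φ ⟧ M w × ⟦ ψ ⟧ M w
⟦ C A φ ⟧         M w = ∀ v → Structure.Rᶜ M A w v → ⟦ φ ⟧ M v
⟦ [ φ ]⁺⟨ A ⟩ ψ ⟧ M w = ⟦ φ ⟧ M w → ⟦ ψ ⟧ (global M w (⟦ φ ⟧ M) A) w
⟦ [ φ ]⁻⟨ A ⟩ ψ ⟧ M w = ⟦ φ ⟧ M w → ⟦ ψ ⟧ (local M w (⟦ φ ⟧ M) A) w

_∣_⊨_ : ∀ {AP n} (M : Model AP n) → Model.W M → Formula AP n → Set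
M ∣ w ⊨ φ = ⟦ φ ⟧ (structure M) w

_≋_ : ∀ {AP n} → Formula AP n → Formula AP n → Set₁
_≋_ {AP} {n} φ ψ = ∀ (M : Model AP n) (w : Model.W M) → (M ∣ w ⊨ φ) ⇔ (M ∣ w ⊨ ψ)

module _ (em : ExcludedMiddle 0ℓ) where

  split-isEquivalence : ∀ {X : Set} {S P : Pred X 0ℓ} {R : Rel X 0ℓ} →
                        (∀ {v u} → R v u → S v → S u) →
                        IsEquivalence R → IsEquivalence (Split S P R)
  split-isEquivalence {X} {S} {P} {R} S-closed eq =
    record { refl = rfl ; sym = sm ; trans = tr }
    where
    open IsEquivalence eq

    rfl : ∀ {v} → Split S P R v v
    rfl {v} with em {S v} | em {P v}
    ... | yes s | yes p = inside (s , p) (refl , p)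
    ... | yes s | no ¬p = outside (s , ¬p) (refl , ¬p)
    ... | no ¬s | _     = otherwise (λ (s , _) → ¬s s) (λ (s , _) → ¬s s) refl

    unsplit : ∀ {v} → ¬ (S v × P v) → ¬ (S v × ¬ P v) → ¬ S v
    unsplit ¬sp ¬s¬p s = ¬s¬p (s , λ p → ¬sp (s , p))

    sm : ∀ {v u} → Split S P R v u → Split S P R u v
    sm (inside (s , p) (r , q))   = inside (S-closed r s , q) (sym r , p)
    sm (outside (s , ¬p) (r , ¬q)) = outside (S-closed r s , ¬q) (sym r , ¬p)
    sm (otherwise i o r) = otherwise (λ (s , _) → ¬s s) (λ (s , _) → ¬s s) (sym r)
      where ¬s = λ s → unsplit i o (S-closed (sym r) s)

    tr : ∀ {v u t} → Split S P R v u → Split S P R u t → Split S P R v t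
    tr (inside sp (r , _))   (inside _ (r′ , q))          = inside sp (trans r r′ , q)
    tr (inside _ (_ , p))    (outside (_ , ¬p) _)         = ⊥-elim (¬p p)
    tr (inside (s , _) (r , p)) (otherwise i _ _)         = ⊥-elim (i (S-closed r s , p))
    tr (outside _ (_ , ¬p))  (inside (_ , p) _)           = ⊥-elim (¬p p)
    tr (outside sp (r , _))  (outside _ (r′ , q))         = outside sp (trans r r′ , q)
    tr (outside (s , _) (r , ¬p)) (otherwise _ o _)       = ⊥-elim (o (S-closed r s , ¬p))
    tr (otherwise i o r) (inside (s , _) _)    = ⊥-elim (unsplit i o (S-closed (sym r) s))
    tr (otherwise i o r) (outside (s , _) _)   = ⊥-elim (unsplit i o (S-closed (sym r) s))
    tr (otherwise i o r) (otherwise _ _ r′)    = otherwise i o (trans r r′)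

  refine-isModel : ∀ {AP n} (M : Structure AP n) {S P} A → IsModel M →
                   (∀ {a v u} → a ∈ A → Structure.R M a v u → S a v → S a u) →
                   IsModel (refine M S P A)
  refine-isModel M A isM S-closed a with a ∈? A
  ... | yes a∈A = split-isEquivalence (S-closed a∈A) (isM a)
  ... | no  _   = isM a

  global-isModel : ∀ {AP n} (M : Structure AP n) w P A → IsModel M → IsModel (global M w P A)
  global-isModel M w P A isM =
    refine-isModel M A isM (λ a∈A r s → s ◅◅ ((_ , a∈A , r) ◅ ε))

  local-isModel : ∀ {AP n} (M : Structure AP n) w P A → IsModel M → IsModel (local M w P A)
  local-isModel M w P A isM =
    refine-isModel M A isM (λ {a} _ r s → IsEquivalence.trans (isM a) s r)

{-# OPTIONS --safe #-}
module Submission where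

-- Formulas of epistemic logic are invariant under bounded morphisms (functional
-- bisimulations), whereas local announcements are not: they modify a single
-- class R_a(w), and not the other classes that are bisimilar to it. Let a
-- two-world model have one p-world, a-linked to one ¬p-world. After announcing
-- p locally to a, only p-worlds can be reached from the p-world. In two copies
-- of this model whose corresponding worlds are linked by the other agents, the
-- announcement cuts the a-link of one copy only, and the ¬p-worlds stay
-- reachable through the other copy. The projection to the two-world model is a
-- bounded morphism, so [p]⁻⟨a⟩ C_Ag p has no equivalent in epistemic logic.

open import Data.Bool using (Bool; true; false)
open import Data.Fin using (Fin; zero; suc)
open import Data.Fin.Subset using (⊤; ⁅_⁆)
open import Data.Fin.Subset.Properties using (_∈?_; ∈⊤)
open import Data.Nat using (ℕ; suc; _≤_; s≤s)
open import Data.Product using (_×_; _,_; ∃-syntax; proj₁; proj₂)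
open import Data.Unit using (tt)
open import Function using (_∘_; const; id; _on_)
open import Function.Bundles using (_⇔_; mk⇔; module Equivalence)
open import Function.Construct.Identity using (⇔-id)
open import Level using (0ℓ)
open import Relation.Binary.Construct.Closure.ReflexiveTransitive using (ε; _◅_)
import Relation.Binary.Construct.On as On
open import Relation.Binary.PropositionalEquality using (_≡_; refl; isEquivalence)
open import Relation.Nullary using (¬_; yes; no)
open import Relation.Unary using (Pred)
open import Defs

open Equivalence using (to; from)

module _ {AP : Set} {n : ℕ} where

  record BoundedMorphism (M N : Structure AP n) : Set where
    private
      module M = Structure M
      module N = Structure N
    field
      f     : M.W → N.W
      atoms : ∀ p x → M.V p x ⇔ N.V p (f x)
      forth : ∀ {a x y} → M.R a x y → N.R a (f x) (f y)
      back  : ∀ {a x v} → N.R a (f x) v → ∃[ y ] M.R a x y × f y ≡ v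

    forthᶜ : ∀ {A x y} → M.Rᶜ A x y → N.Rᶜ A (f x) (f y)
    forthᶜ ε                    = ε
    forthᶜ ((a , a∈A , r) ◅ rs) = (a , a∈A , forth r) ◅ forthᶜ rs

    backᶜ : ∀ {A x v} → N.Rᶜ A (f x) v → ∃[ y ] M.Rᶜ A x y × f y ≡ v
    backᶜ ε = _ , ε , refl
    backᶜ ((a , a∈A , r) ◅ rs) with back r
    -- Matching `refl` makes the intermediate world an image under `f`, so the rest of the path
    -- lifts from there.
    ... | _ , r′ , refl with backᶜ rs
    ...   | z , rs′ , eq = z , (a , a∈A , r′) ◅ rs′ , eq

    EL-invariant : ∀ {φ} → EL φ → ∀ x → ⟦ φ ⟧ M x ⇔ ⟦ φ ⟧ N (f x)
    EL-invariant (atom p) x = atoms p x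
    EL-invariant (¬′ e)   x = mk⇔ (_∘ from (EL-invariant e x)) (_∘ to (EL-invariant e x))
    EL-invariant (d ∧′ e) x =
      mk⇔ (λ (s , t) → to (EL-invariant d x) s , to (EL-invariant e x) t)
          (λ (s , t) → from (EL-invariant d x) s , from (EL-invariant e x) t)
    EL-invariant {C A φ} (C A e) x = mk⇔ pushed pulled
      where
      pushed : ⟦ C A φ ⟧ M x → ⟦ C A φ ⟧ N (f x)
      pushed h v rs with backᶜ rs
      ... | y , rs′ , refl = to (EL-invariant e y) (h y rs′)

      pulled : ⟦ C A φ ⟧ N (f x) → ⟦ C A φ ⟧ M x
      pulled h y rs = from (EL-invariant e y) (h (f y) (forthᶜ rs))

  refine⇒R : ∀ (M : Structure AP n) S P A {a v u} →
             Structure.R (refine M S P A) a v u → Structure.R M a v u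
  refine⇒R M S P A {a} r with a ∈? A
  ... | no _ = r
  ... | yes _ with r
  ...   | inside _ (r′ , _)  = r′
  ...   | outside _ (r′ , _) = r′
  ...   | otherwise _ _ r′   = r′

module _ {AP : Set} {m : ℕ} where

  -- Kernels of functions are equivalences at once. All atoms share the extension `P`, so atoms need
  -- not be compared.
  kernelModel : {X Y Z : Set} → (X → Y) → (X → Z) → Pred X 0ℓ → Model AP (suc m)
  kernelModel {X} f g P = record
    { structure = record
      { W = X
      ; R = λ { zero → _≡_ on f ; (suc _) → _≡_ on g }
      ; V = const P
      }
    ; isModel = λ { zero    → On.isEquivalence f isEquivalence
                  ; (suc _) → On.isEquivalence g isEquivalence }
    }

  -- A world of `double` is a copy paired with a world of `single`: agent `zero` moves within a
  -- copy, the others between copies.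
  single double : Model AP (suc m)
  single = kernelModel {Bool} (const tt) id (_≡ true)
  double = kernelModel {Bool × Bool} proj₁ proj₂ ((_≡ true) ∘ proj₂)

  projection : BoundedMorphism (structure double) (structure single)
  projection = record
    { f     = proj₂
    ; atoms = λ _ _ → ⇔-id _
    ; forth = λ { {zero} _ → refl ; {suc _} r → r }
    ; back  = λ { {zero} {i , _} {v} _ → (i , v) , refl , refl
                ; {suc _} {x} r → x , refl , r }
    }

localAnnouncement : ∀ {AP m} → AP → Formula AP (suc m)
localAnnouncement p = [ atom p ]⁻⟨ ⁅ zero ⁆ ⟩ C ⊤ (atom p)

single⊨ : ∀ {AP m} (p : AP) → single {AP} {m} ∣ true ⊨ localAnnouncement p
single⊨ {AP} {m} p _ v = reach refl
  where
  M N : Structure AP (suc m)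
  M = structure single
  N = local M true (_≡ true) ⁅ zero ⁆

  step : ∀ a {v u} → v ≡ true → Structure.R N a v u → u ≡ true
  step zero    v≡t (inside _ (_ , u≡t))   = u≡t
  step zero    v≡t (outside (_ , v≢t) _) with () ← v≢t v≡t
  -- Agent `zero` links all worlds of `single`, so `v` lies in the class that is split.
  step zero    v≡t (otherwise ¬in _ _)   with () ← ¬in (refl , v≡t)
  -- For a variable `i` the test `suc i ∈? ⁅ zero ⁆` does not reduce; that refining adds no links is
  -- enough.
  step (suc i) refl r with refl ← refine⇒R M (λ a → Structure.R M a true) (_≡ true) ⁅ zero ⁆ {suc i} r = refl

  reach : ∀ {v u} → v ≡ true → Structure.Rᶜ N ⊤ v u → u ≡ true
  reach v≡t ε                  = v≡t
  reach v≡t ((a , _ , r) ◅ rs) = reach (step a v≡t r) rs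

double⊭ : ∀ {AP m} (p : AP) → ¬ (double {AP} {suc m} ∣ (true , true) ⊨ localAnnouncement p)
double⊭ p h with () ← h refl (false , false)
  -- Agent `suc zero` crosses to copy `false`, whose `zero`-class the announcement in copy `true`
  -- leaves whole.
  ( _◅_ {j = false , true} (suc zero , ∈⊤ , refl)
  ((zero , ∈⊤ , otherwise (λ ()) (λ ()) refl) ◅ ε))

theorem6 : (AP : Set) (n : ℕ) →
    ((φ : Formula AP n) → EL φ → ∃[ ψ ] φ ≋ ψ)
    × (AP → 2 ≤ n → ∃[ φ ] ((ψ : Formula AP n) → EL ψ → ¬ (φ ≋ ψ)))
theorem6 AP n = (λ φ _ → φ , λ _ _ → ⇔-id _) , strict
  where
  strict : ∀ {n} → AP → 2 ≤ n → ∃[ φ ] ((ψ : Formula AP n) → EL ψ → ¬ (φ ≋ ψ))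
  -- The match exposes the two agents that the crossing path needs.
  strict p (s≤s (s≤s _)) = localAnnouncement p , λ ψ e φ≋ψ →
    double⊭ p (from (φ≋ψ double _)
      (from (BoundedMorphism.EL-invariant projection e (true , true))
        (to (φ≋ψ single true) (single⊨ p))))
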